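{- Suppose $n=2^m-1$ for some integer $m\ge 0$. For $k\ge 0$ let $A_{n,k}(1)=[t^k]M_n(1,t)$ be the coefficient of $t^k$ in $M_n(1,t)$, i.e. the number of permutations $\sigma\in\mathrm{Av}_n(321)$ with $\mathrm{des}\,\sigma=k$. Then $A_{n,0}(1)=1$, and $A_{n,k}(1)$ is an even integer for every $k\ge 1$.
   Context: Let $\mathfrak S_n$ be the symmetric group of permutations $\sigma=b_1\ldots b_n$ (in one-line notation) of $[n]=\{1,\ldots,n\}$; $\mathfrak S_0$ consists of the empty permutation. Let $\mathrm{Av}_n(321)$ be the set of $\sigma=b_1\ldots b_n\in\mathfrak S_n$ avoiding the pattern $321$, i.e. such that there are no indices $i<j<l$ with $b_i>b_j>b_l$. For $\sigma=b_1\ldots b_n$ let $\mathrm{Des}\,\sigma=\{i \mid 1\le i\le n-1,\ b_i>b_{i+1}\}$, $\mathrm{des}\,\sigma=\#\mathrm{Des}\,\sigma$ (number of descents), and $\mathrm{maj}\,\sigma=\sum_{i\in\mathrm{Des}\,\sigma} i$ (major index). Define $M_n(q,t)=\sum_{\sigma\in\mathrm{Av}_n(321)}q^{\mathrm{maj}\,\sigma}t^{\mathrm{des}\,\sigma}$ and let $A_{n,k}(q)$ be the coefficient of $t^k$ in $M_n(q,t)$. The integer $0$ counts as even. -}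

module Defs where

open import Data.Bool.Base using (true; false; if_then_else_)
open import Data.Fin.Base using (Fin; toℕ) renaming (_<_ to _<ᶠ_; _>_ to _>ᶠ_)
open import Data.Fin.Properties using (all?; any?)
  renaming (_≟_ to _≟ᶠ_; _<?_ to _<ᶠ?_)
open import Data.List.Base
  using (List; []; _∷_; [_]; map; filter; length; allFin; cartesianProductWith)
open import Data.Nat.Base using (ℕ; zero; suc; _+_; _^_; _≡ᵇ_)
open import Data.Nat.ListAction using (sum)
open import Data.Nat.Properties using (_≟_; ^-zeroˡ)
open import Data.Product.Base using (∃-syntax; _×_; _,_)
open import Data.Vec.Base using (Vec; lookup) renaming ([] to []ᵛ; _∷_ to _∷ᵛ_)
open import Function.Base using (_∘_)
open import Function.Definitions using (Bijective)
open import Relation.Binary.PropositionalEquality.Core using (_≡_; refl; cong₂)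
open import Relation.Nullary using (¬_; Dec)
open import Relation.Nullary.Decidable using (map′; ¬?; _×-dec_; _→-dec_)

-- Words b₁…bₙ over the alphabet [a].  Letters and positions are elements of
-- Fin, hence numbered from 0: the element i of Fin stands for toℕ i + 1.
Word : ℕ → ℕ → Set
Word a n = Vec (Fin a) n

IsPermutation : ∀ {n} → Word n n → Set
IsPermutation σ = Bijective _≡_ _≡_ (lookup σ)

isPermutation? : ∀ {n} (σ : Word n n) → Dec (IsPermutation σ)
isPermutation? σ =
  map′ (λ inj {x} {y} → inj x y) (λ inj x y → inj)
    (all? λ x → all? λ y → (lookup σ x ≟ᶠ lookup σ y) →-dec (x ≟ᶠ y))
  ×-dec
  all? λ y → map′
    (λ { (x , eq) → x , λ { refl → eq } })
    (λ { (x , eq) → x , eq refl })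
    (any? λ x → lookup σ x ≟ᶠ y)

Avoids321 : ∀ {a n} → Word a n → Set
Avoids321 {n = n} σ =
  ¬ (∃[ i ] ∃[ j ] ∃[ l ] (i <ᶠ j × j <ᶠ l ×
       lookup σ i >ᶠ lookup σ j × lookup σ j >ᶠ lookup σ l))

avoids321? : ∀ {a n} (σ : Word a n) → Dec (Avoids321 σ)
avoids321? σ =
  ¬? (any? λ i → any? λ j → any? λ l → (i <ᶠ? j) ×-dec (j <ᶠ? l) ×-dec
       (lookup σ j <ᶠ? lookup σ i) ×-dec (lookup σ l <ᶠ? lookup σ j))

-- The last position has no successor j, so it is never a descent.
IsDescent : ∀ {a n} → Word a n → Fin n → Set
IsDescent σ i = ∃[ j ] (toℕ j ≡ suc (toℕ i) × lookup σ i >ᶠ lookup σ j)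

isDescent? : ∀ {a n} (σ : Word a n) (i : Fin n) → Dec (IsDescent σ i)
isDescent? σ i =
  any? λ j → (toℕ j ≟ suc (toℕ i)) ×-dec (lookup σ j <ᶠ? lookup σ i)

Des : ∀ {a n} → Word a n → List (Fin n)
Des {n = n} σ = filter (isDescent? σ) (allFin n)

des : ∀ {a n} → Word a n → ℕ
des σ = length (Des σ)

maj : ∀ {a n} → Word a n → ℕ
maj σ = sum (map (suc ∘ toℕ) (Des σ))

-- Every word occurs exactly once, so that filtering and counting is cardinality.
allWords : ∀ a n → List (Word a n)
allWords a zero    = [ []ᵛ ]
allWords a (suc n) = cartesianProductWith _∷ᵛ_ (allFin a) (allWords a n)

𝔖 : ∀ n → List (Word n n)
𝔖 n = filter isPermutation? (allWords n n)

Av321 : ∀ n → List (Word n n)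
Av321 n = filter avoids321? (𝔖 n)

-- Polynomials in t with natural coefficients, as coefficient sequences.
Poly : Set
Poly = ℕ → ℕ

[t^_]_ : ℕ → Poly → ℕ
[t^ k ] p = p k

infix 9 _·t^_

_·t^_ : ℕ → ℕ → Poly
(c ·t^ d) k = if d ≡ᵇ k then c else 0

sumₚ : List Poly → Poly
sumₚ ps k = sum (map ([t^ k ]_) ps)

-- M n q is Mₙ(q,t) with t formal and q evaluated at a natural number.
M : ℕ → ℕ → Poly
M n q = sumₚ (map (λ σ → (q ^ maj σ) ·t^ des σ) (Av321 n))

A : ℕ → ℕ → ℕ → ℕ
A n k q = [t^ k ] M n q

A-count : ∀ n k → A n k 1 ≡ length (filter (λ σ → des σ ≟ k) (Av321 n))
A-count n k = go maj des (Av321 n)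
  where
  go : ∀ {X : Set} (e d : X → ℕ) (xs : List X) →
       [t^ k ] sumₚ (map (λ x → (1 ^ e x) ·t^ d x) xs) ≡
       length (filter (λ x → d x ≟ k) xs)
  go e d [] = refl
  go e d (x ∷ xs) with d x ≡ᵇ k
  ... | true  = cong₂ _+_ (^-zeroˡ (e x)) (go e d xs)
  ... | false = go e d xs

{-# OPTIONS --safe #-}
-- Reverse-complementation rc is an involution of Avₙ(321) preserving des, so
-- modulo 2 only its fixed points count.  If n = 2h + 1, a fixed point fixes the
-- middle letter, and avoiding 321 forces it to be σ ⊕ 1 ⊕ rc σ with
-- σ ∈ Av_h(321); it has 2 des σ descents.  Hence A_{2h+1,k}(1) is congruent
-- modulo 2 to A_{h,k/2}(1), or to 0 when k is odd, and induction on m applies.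
module Submission where

open import Defs
open import Data.Bool.Base using (true; false; if_then_else_)
open import Data.Empty using (⊥; ⊥-elim)
open import Data.Fin.Base
  using (Fin; zero; suc; toℕ; opposite; splitAt; inject₁; fromℕ; fromℕ<; _↑ˡ_; _↑ʳ_)
  renaming (_<_ to _<ᶠ_)
import Data.Fin.Permutation as Permutation
open import Data.Fin.Properties
  using (toℕ-injective; toℕ-inject₁; toℕ-fromℕ; toℕ<n; toℕ-↑ˡ; toℕ-↑ʳ; ↑ˡ-injective;
         toℕ-fromℕ<; splitAt-↑ˡ; splitAt-↑ʳ; opposite-prop; opposite-involutive; any?)
  renaming (_≟_ to _≟ᶠ_; _<?_ to _<ᶠ?_)
open import Data.List.Base
  using (List; []; _∷_; [_]; _++_; map; filter; length; tabulate; allFin)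
open import Data.List.Membership.Propositional using (_∈_; lose)
open import Data.List.Membership.Propositional.Properties
  using (∈-filter⁺; ∈-filter⁻; ∈-map⁺; ∈-map⁻; ∈-∃++; ∈-allFin;
         ∈-cartesianProductWith⁺)
open import Data.List.Membership.Propositional.Properties.WithK using (unique∧set⇒bag)
open import Data.List.Properties using (length-map; filter-none; filter-some)
open import Data.List.Relation.Binary.BagAndSetEquality using (∼bag⇒↭)
open import Data.List.Relation.Binary.Permutation.Propositional
  using (_↭_; ↭-sym; ↭-prep; ↭⇒↭ₛ)
open import Data.List.Relation.Binary.Permutation.Propositional.Properties
  using (shift; ↭-length; ∈-resp-↭)
open import Data.List.Relation.Unary.All as All using (All; []; _∷_)
open import Data.List.Relation.Unary.AllPairs using ([]; _∷_)
open import Data.List.Relation.Unary.Any using (here; there)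
open import Data.List.Relation.Unary.Unique.Propositional using (Unique)
import Data.List.Relation.Unary.Unique.Propositional.Properties as Unique
open import Data.Nat.Base
  using (ℕ; zero; suc; _+_; _∸_; _^_; _≤_; _<_; _≥_; z≤n; s≤s)
open import Data.Nat.Divisibility using (_∣_; _∣0; ∣-refl; ∣m∣n⇒∣m+n)
open import Data.Nat.Induction using (<-wellFounded)
open import Data.Nat.Properties
open import Data.Product.Base using (∃-syntax; _×_; _,_; proj₁; proj₂)
open import Data.Sum.Base using (_⊎_; inj₁; inj₂)
open import Data.Vec.Base as Vec using (Vec; lookup) renaming ([] to []ᵛ; _∷_ to _∷ᵛ_)
open import Data.Vec.Properties
  using (≡-dec; lookup∘tabulate; tabulate∘lookup; tabulate-cong; ∷-injective)
open import Function.Base using (_∘_; id)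
open import Function.Bundles using (mk⇔)
open import Function.Definitions using (Surjective)
open import Induction.WellFounded using (Acc; acc)
open import Relation.Binary.Definitions using (tri<; tri≈; tri>)
open import Relation.Binary.PropositionalEquality hiding ([_])
open import Relation.Nullary using (¬_; Dec; yes; no; does; contradiction)
open import Relation.Nullary.Decidable using (does-⇔; ¬?; _×-dec_)
open import Relation.Unary using (Decidable)

open import Algebra.Properties.CommutativeMonoid.Sum +-0-commutativeMonoid
  using (sum; sum-cong-≗; sum-init-last; sum-permute)
import Data.List.Relation.Binary.Permutation.Setoid.Properties as Permutationₛ

private
  variable
    X : Set
    a h n k : ℕ

-- Parity of repetition-free lists under an involution.

Unique-resp-↭ : {xs ys : List X} → xs ↭ ys → Unique xs → Unique ys
Unique-resp-↭ p = Permutationₛ.Unique-resp-↭ (setoid _) (↭⇒↭ₛ p)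

Unique⇒↭ : {xs ys : List X} → Unique xs → Unique ys →
           (∀ {x} → x ∈ xs → x ∈ ys) → (∀ {x} → x ∈ ys → x ∈ xs) → xs ↭ ys
Unique⇒↭ uxs uys ⊆ ⊇ = ∼bag⇒↭ (unique∧set⇒bag uxs uys (mk⇔ ⊆ ⊇))

-- Elements pair off as `x` and `f x`; removing one pair leaves a closed list that is shorter by
-- two. The remainder is not a sublist in the structural sense, hence the recursion on `Acc` of the
-- length.
fixedPointFree⇒even :
  (f : X → X) → (∀ x → f (f x) ≡ x) →
  (xs : List X) → Acc _<_ (length xs) → Unique xs →
  (∀ {x} → x ∈ xs → f x ∈ xs) → (∀ {x} → x ∈ xs → f x ≢ x) → 2 ∣ length xs
fixedPointFree⇒even f inv [] _ _ _ _ = 2 ∣0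
fixedPointFree⇒even f inv (x ∷ ys) (acc rs) u closed free with closed (here refl)
... | here eq = contradiction eq (free (here refl))
... | there fx∈ with ∈-∃++ fx∈
... | as , bs , refl = subst (2 ∣_) (sym (↭-length perm))
      (∣m∣n⇒∣m+n ∣-refl
        (fixedPointFree⇒even f inv zs
          (rs (subst (length zs <_) (sym (↭-length perm)) (m≤n+m _ 1)))
          uzs closed′ (free ∘ up)))
  where
  zs = as ++ bs
  perm : x ∷ as ++ [ f x ] ++ bs ↭ x ∷ f x ∷ zs
  perm = ↭-prep x (shift (f x) as bs)
  u′ = Unique-resp-↭ perm u
  x∉ : All (x ≢_) (f x ∷ zs)
  x∉ with u′
  ... | p ∷ _ = p
  fx∉ : All (f x ≢_) zs
  fx∉ with u′
  ... | _ ∷ q ∷ _ = q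
  uzs : Unique zs
  uzs with u′
  ... | _ ∷ _ ∷ r = r
  up : ∀ {z} → z ∈ zs → z ∈ x ∷ as ++ [ f x ] ++ bs
  up z∈ = ∈-resp-↭ (↭-sym perm) (there (there z∈))
  closed′ : ∀ {z} → z ∈ zs → f z ∈ zs
  -- The image of `z` is neither removed element: `f z ≡ x` would give `z ≡ f x`, and `f z ≡ f x`
  -- would give `z ≡ x`, while `zs` contains neither.
  closed′ {z} z∈ with ∈-resp-↭ perm (closed (up z∈))
  ... | here eq = contradiction (trans (cong f (sym eq)) (inv z)) (All.lookup fx∉ z∈)
  ... | there (here eq) =
        contradiction (trans (sym (inv x)) (trans (cong f (sym eq)) (inv z)))
                      (All.lookup x∉ (there z∈))
  ... | there (there fz∈) = fz∈

length-filter-split : {P : X → Set} (P? : Decidable P) (xs : List X) →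
  length xs ≡ length (filter P? xs) + length (filter (¬? ∘ P?) xs)
length-filter-split P? [] = refl
length-filter-split P? (x ∷ xs) with does (P? x)
... | true  = cong suc (length-filter-split P? xs)
... | false = trans (cong suc (length-filter-split P? xs)) (sym (+-suc _ _))

-- The moved elements form an even part by `fixedPointFree⇒even`. They are closed under `f`, because
-- a fixed `f x` would make `x` itself fixed.
involution-even :
  (f : X → X) → (∀ x → f (f x) ≡ x) → (fixed? : Decidable (λ x → f x ≡ x)) →
  (xs : List X) → Unique xs → (∀ {x} → x ∈ xs → f x ∈ xs) →
  2 ∣ length (filter fixed? xs) → 2 ∣ length xs
involution-even f inv fixed? xs u closed even =
  subst (2 ∣_) (sym (length-filter-split fixed? xs))
    (∣m∣n⇒∣m+n even
      (fixedPointFree⇒even f inv moved (<-wellFounded _) (Unique.filter⁺ (¬? ∘ fixed?) u)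
        (λ x∈ → let x∈xs , ne = split x∈ in
          ∈-filter⁺ (¬? ∘ fixed?) (closed x∈xs)
            (λ eq → ne (trans (sym eq) (inv _))))
        (proj₂ ∘ split)))
  where
  moved = filter (¬? ∘ fixed?) xs
  split : ∀ {x} → x ∈ moved → x ∈ xs × ¬ (f x ≡ x)
  split = ∈-filter⁻ (¬? ∘ fixed?)

-- Indicators and finite sums.

indicator : {P : Set} → Dec P → ℕ
indicator P? = if does P? then 1 else 0

indicator-cong : {P Q : Set} (P? : Dec P) (Q? : Dec Q) → (P → Q) → (Q → P) →
                 indicator P? ≡ indicator Q?
indicator-cong P? Q? to from =
  cong (if_then 1 else 0) (does-⇔ (mk⇔ to from) P? Q?)

indicator-no : {P : Set} (P? : Dec P) → ¬ P → indicator P? ≡ 0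
indicator-no (yes p) ¬p = contradiction p ¬p
indicator-no (no _)  _  = refl

length-filter-tabulate : {P : X → Set} (P? : Decidable P) (f : Fin n → X) →
  length (filter P? (tabulate f)) ≡ sum (indicator ∘ P? ∘ f)
length-filter-tabulate {n = zero}  P? f = refl
length-filter-tabulate {n = suc n} P? f with does (P? (f zero))
... | true  = cong suc (length-filter-tabulate P? (f ∘ suc))
... | false = length-filter-tabulate P? (f ∘ suc)

sum-↑ : ∀ m {n} (f : Fin (m + n) → ℕ) →
        sum f ≡ sum (λ i → f (i ↑ˡ n)) + sum (λ j → f (m ↑ʳ j))
sum-↑ zero    f = refl
sum-↑ (suc m) f =
  trans (cong (f zero +_) (sum-↑ m (f ∘ suc))) (sym (+-assoc (f zero) _ _))

sum-opposite : (f : Fin n → ℕ) → sum f ≡ sum (f ∘ opposite)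
sum-opposite f = sum-permute f Permutation.reverse

-- Order reversal on `Fin n`.

-- The additive form avoids truncated subtraction, so that later facts about `opposite` follow by
-- cancelling or comparing sums.
opposite-+ : (i : Fin n) → toℕ (opposite i) + suc (toℕ i) ≡ n
opposite-+ i = trans (cong (_+ suc (toℕ i)) (opposite-prop i)) (m∸n+n≡m (toℕ<n i))

opposite-injective : {i j : Fin n} → opposite i ≡ opposite j → i ≡ j
opposite-injective {i = i} {j} eq =
  trans (sym (opposite-involutive i)) (trans (cong opposite eq) (opposite-involutive j))

opposite-anti : {i j : Fin n} → i <ᶠ j → opposite j <ᶠ opposite i
opposite-anti {i = i} {j} i<j = ≰⇒> λ le →
  <-irrefl (trans (opposite-+ i) (sym (opposite-+ j))) (+-mono-≤-< le (s≤s i<j))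

opposite-anti⁻ : {i j : Fin n} → opposite j <ᶠ opposite i → i <ᶠ j
opposite-anti⁻ lt =
  subst₂ _<ᶠ_ (opposite-involutive _) (opposite-involutive _) (opposite-anti lt)

opposite-next : {i j : Fin n} → toℕ j ≡ suc (toℕ i) →
                toℕ (opposite i) ≡ suc (toℕ (opposite j))
opposite-next {i = i} {j} eq = +-cancelʳ-≡ (suc (toℕ i)) _ _ (begin
  toℕ (opposite i) + suc (toℕ i)       ≡⟨ trans (opposite-+ i) (sym (opposite-+ j)) ⟩
  toℕ (opposite j) + suc (toℕ j)       ≡⟨ cong (λ x → toℕ (opposite j) + suc x) eq ⟩
  toℕ (opposite j) + suc (suc (toℕ i)) ≡⟨ +-suc _ _ ⟩
  suc (toℕ (opposite j)) + suc (toℕ i) ∎)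
  where open ≡-Reasoning

Vec-ext : {v w : Vec X n} → (∀ i → lookup v i ≡ lookup w i) → v ≡ w
Vec-ext {v = v} {w} eq =
  trans (sym (tabulate∘lookup v)) (trans (tabulate-cong eq) (tabulate∘lookup w))

-- The descent number as a sum of indicators.

-- Counting descents by their bottoms i + 1 instead of their tops i makes the
-- count symmetric under reversal.
IsBottom : Word a n → Fin n → Set
IsBottom σ i = ∃[ j ] (toℕ i ≡ suc (toℕ j) × lookup σ i <ᶠ lookup σ j)

isBottom? : (σ : Word a n) (i : Fin n) → Dec (IsBottom σ i)
isBottom? σ i = any? λ j → (toℕ i ≟ suc (toℕ j)) ×-dec (lookup σ i <ᶠ? lookup σ j)

des-tops : (σ : Word a n) → des σ ≡ sum (indicator ∘ isDescent? σ)
des-tops σ = length-filter-tabulate (isDescent? σ) id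

-- A descent with top `inject₁ i` has bottom `suc i`, so the two sums differ by a shift: the last
-- position is never a top and the first is never a bottom.
des-bottoms : (σ : Word a n) → des σ ≡ sum (indicator ∘ isBottom? σ)
des-bottoms {n = zero}  σ = refl
des-bottoms {n = suc n} σ = begin
  des σ                                    ≡⟨ des-tops σ ⟩
  sum top                                  ≡⟨ sum-init-last top ⟩
  sum (top ∘ inject₁) + top (fromℕ n)      ≡⟨ cong (sum (top ∘ inject₁) +_) (indicator-no (isDescent? σ (fromℕ n)) last) ⟩
  sum (top ∘ inject₁) + 0                  ≡⟨ +-identityʳ _ ⟩
  sum (top ∘ inject₁)                      ≡⟨ sum-cong-≗ step ⟩
  sum (bottom ∘ suc)                       ≡⟨ cong (_+ sum (bottom ∘ suc)) (indicator-no (isBottom? σ zero) first) ⟨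
  sum bottom                               ∎
  where
  open ≡-Reasoning
  top    = indicator ∘ isDescent? σ
  bottom = indicator ∘ isBottom? σ
  last : ¬ IsDescent σ (fromℕ n)
  last (j , eq , _) = <-irrefl (trans eq (cong suc (toℕ-fromℕ n))) (toℕ<n j)
  first : ¬ IsBottom σ zero
  first (_ , () , _)
  step : ∀ i → top (inject₁ i) ≡ bottom (suc i)
  step i = indicator-cong (isDescent? σ (inject₁ i)) (isBottom? σ (suc i))
    (λ { (j , eq , gt) → inject₁ i , cong suc (sym (toℕ-inject₁ i)) ,
           subst (λ x → lookup σ x <ᶠ lookup σ (inject₁ i))
             (toℕ-injective (trans eq (cong suc (toℕ-inject₁ i)))) gt })
    (λ { (j , eq , lt) → suc i , cong suc (sym (toℕ-inject₁ i)) ,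
           subst (λ x → lookup σ (suc i) <ᶠ lookup σ x)
             (toℕ-injective (trans (suc-injective (sym eq)) (sym (toℕ-inject₁ i)))) lt })

-- Reverse-complementation.

rc : Word a n → Word a n
rc σ = Vec.tabulate (opposite ∘ lookup σ ∘ opposite)

lookup-rc : (σ : Word a n) (i : Fin n) → lookup (rc σ) i ≡ opposite (lookup σ (opposite i))
lookup-rc σ = lookup∘tabulate _

lookup-rc-opposite : (σ : Word a n) (i : Fin n) →
                     lookup (rc σ) (opposite i) ≡ opposite (lookup σ i)
lookup-rc-opposite σ i =
  trans (lookup-rc σ (opposite i)) (cong (opposite ∘ lookup σ) (opposite-involutive i))

rc-involutive : (σ : Word a n) → rc (rc σ) ≡ σ
rc-involutive σ = Vec-ext λ i →
  trans (lookup-rc (rc σ) i)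
    (trans (cong opposite (lookup-rc-opposite σ i)) (opposite-involutive _))

rc-<⁻ : (σ : Word a n) {i j : Fin n} → lookup (rc σ) i <ᶠ lookup (rc σ) j →
        lookup σ (opposite j) <ᶠ lookup σ (opposite i)
rc-<⁻ σ {i} {j} lt = opposite-anti⁻ (subst₂ _<ᶠ_ (lookup-rc σ i) (lookup-rc σ j) lt)

rc-IsPermutation : (σ : Word n n) → IsPermutation σ → IsPermutation (rc σ)
rc-IsPermutation σ (inj , surj) =
  (λ {x} {y} eq → opposite-injective (inj (opposite-injective
     (trans (sym (lookup-rc σ x)) (trans eq (lookup-rc σ y)))))) ,
  λ y → let x , eq = surj (opposite y) in
    opposite x , λ { refl →
      trans (lookup-rc-opposite σ x)
        (trans (cong opposite (eq refl)) (opposite-involutive y)) }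

-- The pattern 321 is its own reverse-complement, so an occurrence in `rc σ` reflects to one in `σ`.
rc-Avoids321 : (σ : Word a n) → Avoids321 σ → Avoids321 (rc σ)
rc-Avoids321 σ av (i , j , l , i<j , j<l , ij , jl) =
  av (opposite l , opposite j , opposite i , opposite-anti j<l , opposite-anti i<j ,
      rc-<⁻ σ jl , rc-<⁻ σ ij)

-- Reversal swaps the two places of an adjacent pair and complementation swaps the order of its
-- letters: a descent stays a descent, but its bottom becomes its top.
rc-top : (σ : Word a n) (i : Fin n) →
         indicator (isDescent? (rc σ) (opposite i)) ≡ indicator (isBottom? σ i)
rc-top σ i = indicator-cong (isDescent? (rc σ) (opposite i)) (isBottom? σ i)
  (λ { (j , eq , gt) → opposite j ,
         trans (cong toℕ (sym (opposite-involutive i))) (opposite-next eq) ,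
         subst (λ x → lookup σ x <ᶠ lookup σ (opposite j)) (opposite-involutive i)
           (rc-<⁻ σ gt) })
  (λ { (j , eq , lt) → opposite j , opposite-next eq ,
         subst₂ _<ᶠ_ (sym (lookup-rc-opposite σ j)) (sym (lookup-rc-opposite σ i))
           (opposite-anti lt) })

-- Summing in reverse order turns the tops of `rc σ` into the bottoms of `σ`, and either kind counts
-- the descents.
des-rc : (σ : Word a n) → des (rc σ) ≡ des σ
des-rc σ = begin
  des (rc σ)                                     ≡⟨ des-tops (rc σ) ⟩
  sum (indicator ∘ isDescent? (rc σ))            ≡⟨ sum-opposite (indicator ∘ isDescent? (rc σ)) ⟩
  sum (indicator ∘ isDescent? (rc σ) ∘ opposite) ≡⟨ sum-cong-≗ (rc-top σ) ⟩
  sum (indicator ∘ isBottom? σ)                  ≡⟨ des-bottoms σ ⟨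
  des σ                                          ∎
  where open ≡-Reasoning

-- The two halves and the middle of 2h + 1 places.

low : Fin h → Fin (h + suc h)
low {h} x = x ↑ˡ suc h

mid : ∀ h → Fin (h + suc h)
mid h = h ↑ʳ zero

toℕ-low : (x : Fin h) → toℕ (low x) ≡ toℕ x
toℕ-low {h} x = toℕ-↑ˡ x (suc h)

toℕ-mid : ∀ h → toℕ (mid h) ≡ h
toℕ-mid h = trans (toℕ-↑ʳ h zero) (+-identityʳ h)

-- Links the reflected form of a place in the right half, suited to symmetry, with the form on which
-- `splitAt` and `sum-↑` work.
opposite-low : (x : Fin h) → opposite (low x) ≡ h ↑ʳ suc (opposite x)
opposite-low {h} x = toℕ-injective (+-cancelʳ-≡ (suc (toℕ x)) _ _ (begin
  toℕ (opposite (low x)) + suc (toℕ x)       ≡⟨ cong (λ y → toℕ (opposite (low x)) + suc y) (toℕ-low x) ⟨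
  toℕ (opposite (low x)) + suc (toℕ (low x)) ≡⟨ opposite-+ (low x) ⟩
  h + suc h                                  ≡⟨ cong (λ y → h + suc y) (opposite-+ x) ⟨
  h + (suc (toℕ (opposite x)) + suc (toℕ x)) ≡⟨ +-assoc h _ _ ⟨
  h + suc (toℕ (opposite x)) + suc (toℕ x)   ≡⟨ cong (_+ suc (toℕ x)) (toℕ-↑ʳ h (suc (opposite x))) ⟨
  toℕ (h ↑ʳ suc (opposite x)) + suc (toℕ x)  ∎))
  where open ≡-Reasoning

-- Such a `p` satisfies p + (p + 1) = h + (h + 1), which excludes both p < h and p > h.
self-opposite⇒mid : {p : Fin (h + suc h)} → opposite p ≡ p → p ≡ mid h
self-opposite⇒mid {h} {p} eq = toℕ-injective (trans (≤-antisym
  (≮⇒≥ λ lt → <-irrefl (sym total) (+-mono-<-≤ lt (s≤s (<⇒≤ lt))))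
  (≮⇒≥ λ lt → <-irrefl total (+-mono-<-≤ lt (s≤s (<⇒≤ lt)))))
  (sym (toℕ-mid h)))
  where
  total : toℕ p + suc (toℕ p) ≡ h + suc h
  total = trans (cong (λ q → toℕ q + suc (toℕ p)) (sym eq)) (opposite-+ p)

opposite-mid : ∀ h → opposite (mid h) ≡ mid h
opposite-mid h = toℕ-injective (+-cancelʳ-≡ (suc h) _ _ (begin
  toℕ (opposite (mid h)) + suc h             ≡⟨ cong (λ x → toℕ (opposite (mid h)) + suc x) (toℕ-mid h) ⟨
  toℕ (opposite (mid h)) + suc (toℕ (mid h)) ≡⟨ opposite-+ (mid h) ⟩
  h + suc h                                  ≡⟨ cong (_+ suc h) (toℕ-mid h) ⟨
  toℕ (mid h) + suc h                        ∎))
  where open ≡-Reasoning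

low<mid : (x : Fin h) → low x <ᶠ mid h
low<mid {h} x = subst₂ _<_ (sym (toℕ-low x)) (sym (toℕ-mid h)) (toℕ<n x)

mid<opposite-low : (x : Fin h) → mid h <ᶠ opposite (low x)
mid<opposite-low {h} x =
  subst (_<ᶠ opposite (low x)) (opposite-mid h) (opposite-anti (low<mid x))

low<opposite-low : (x y : Fin h) → low x <ᶠ opposite (low y)
low<opposite-low x y = <-trans (low<mid x) (mid<opposite-low y)

low-mono : {x y : Fin h} → x <ᶠ y → low x <ᶠ low y
low-mono {x = x} {y} = subst₂ _<_ (sym (toℕ-low x)) (sym (toℕ-low y))

low-mono⁻ : {x y : Fin h} → low x <ᶠ low y → x <ᶠ y
low-mono⁻ {x = x} {y} = subst₂ _<_ (toℕ-low x) (toℕ-low y)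

low-injective : {x y : Fin h} → low x ≡ low y → x ≡ y
low-injective {h} = ↑ˡ-injective (suc h) _ _

-- Places right of the middle are indexed by their reflections, so that `opposite` exchanges
-- `left x` and `right x` without index arithmetic. The view serves positions and letters alike.
data Block {h} : Fin (h + suc h) → Set where
  left   : ∀ x → Block (low x)
  middle : Block (mid h)
  right  : ∀ x → Block (opposite (low x))

block : (p : Fin (h + suc h)) → Block p
block {h} p with <-cmp (toℕ p) h
... | tri< lt _ _ = subst Block (toℕ-injective (trans (toℕ-low _) (toℕ-fromℕ< lt))) (left (fromℕ< lt))
... | tri≈ _ eq _ = subst Block (toℕ-injective (trans (toℕ-mid h) (sym eq))) middle
-- A place beyond the middle is reflected into the left half, where its index is read off.
... | tri> _ _ gt =
  subst Block (trans (cong opposite eq) (opposite-involutive p)) (right (fromℕ< lt))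
  where
  lt : toℕ (opposite p) < h
  lt = subst₂ _<_ refl (trans (cong toℕ (opposite-mid h)) (toℕ-mid h))
         (opposite-anti (subst (_< toℕ p) (sym (toℕ-mid h)) gt))
  eq : low (fromℕ< lt) ≡ opposite p
  eq = toℕ-injective (trans (toℕ-low _) (toℕ-fromℕ< lt))

below-low : {p : Fin (h + suc h)} {x : Fin h} → p <ᶠ low x → ∃[ y ] p ≡ low y
below-low {p = p} {x} lt with block p
... | left y  = y , refl
... | middle  = ⊥-elim (<-asym lt (low<mid x))
... | right y = ⊥-elim (<-asym lt (low<opposite-low x y))

-- The symmetric word built from σ.

-- The right half is numbered outwards from the middle and the left half towards it, hence
-- `opposite y` in the last clause.
mirrorLetter : Word h h → Fin h ⊎ Fin (suc h) → Fin (h + suc h)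
mirrorLetter     σ (inj₁ x)       = low (lookup σ x)
mirrorLetter {h} σ (inj₂ zero)    = mid h
mirrorLetter     σ (inj₂ (suc y)) = opposite (low (lookup σ (opposite y)))

-- σ ⊕ 1 ⊕ rc σ
mirror : Word h h → Word (h + suc h) (h + suc h)
mirror {h} σ = Vec.tabulate (mirrorLetter σ ∘ splitAt h)

module _ (σ : Word h h) where

  mirror-low : ∀ x → lookup (mirror σ) (low x) ≡ low (lookup σ x)
  mirror-low x =
    trans (lookup∘tabulate _ (low x)) (cong (mirrorLetter σ) (splitAt-↑ˡ h x (suc h)))

  mirror-mid : lookup (mirror σ) (mid h) ≡ mid h
  mirror-mid =
    trans (lookup∘tabulate _ (mid h)) (cong (mirrorLetter σ) (splitAt-↑ʳ h (suc h) zero))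

  mirror-right : ∀ x → lookup (mirror σ) (opposite (low x)) ≡ opposite (low (lookup σ x))
  mirror-right x = begin
    lookup (mirror σ) (opposite (low x))                  ≡⟨ lookup∘tabulate _ (opposite (low x)) ⟩
    mirrorLetter σ (splitAt h (opposite (low x)))         ≡⟨ cong (mirrorLetter σ ∘ splitAt h) (opposite-low x) ⟩
    mirrorLetter σ (splitAt h (h ↑ʳ suc (opposite x)))    ≡⟨ cong (mirrorLetter σ) (splitAt-↑ʳ h (suc h) (suc (opposite x))) ⟩
    opposite (low (lookup σ (opposite (opposite x))))     ≡⟨ cong (opposite ∘ low ∘ lookup σ) (opposite-involutive x) ⟩
    opposite (low (lookup σ x))                           ∎
    where open ≡-Reasoning

  rc-mirror : rc (mirror σ) ≡ mirror σ
  rc-mirror = Vec-ext λ p → trans (lookup-rc (mirror σ) p) (go p (block p))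
    where
    go : ∀ p → Block p → opposite (lookup (mirror σ) (opposite p)) ≡ lookup (mirror σ) p
    go _ (left x)  = trans (cong opposite (mirror-right x))
                       (trans (opposite-involutive _) (sym (mirror-low x)))
    go _ middle    = trans (cong (opposite ∘ lookup (mirror σ)) (opposite-mid h))
                       (trans (cong opposite mirror-mid) (trans (opposite-mid h) (sym mirror-mid)))
    go _ (right x) = trans (cong (opposite ∘ lookup (mirror σ)) (opposite-involutive (low x)))
                       (trans (cong opposite (mirror-low x)) (sym (mirror-right x)))

  -- Each block of positions carries letters of the same block, so no inversion crosses a block
  -- boundary. This fact and the next two confine patterns and descents to one half.
  mirror-mid≮low : ∀ {x} → ¬ (lookup (mirror σ) (mid h) <ᶠ lookup (mirror σ) (low x))
  mirror-mid≮low {x} lt = <-asym (subst₂ _<ᶠ_ mirror-mid (mirror-low x) lt) (low<mid _)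

  mirror-right≮low : ∀ {x y} →
    ¬ (lookup (mirror σ) (opposite (low y)) <ᶠ lookup (mirror σ) (low x))
  mirror-right≮low {x} {y} lt =
    <-asym (subst₂ _<ᶠ_ (mirror-right y) (mirror-low x) lt) (low<opposite-low _ _)

  mirror-right≮mid : ∀ {y} →
    ¬ (lookup (mirror σ) (opposite (low y)) <ᶠ lookup (mirror σ) (mid h))
  mirror-right≮mid {y} lt =
    <-asym (subst₂ _<ᶠ_ (mirror-right y) mirror-mid lt) (mid<opposite-low _)

  mirror-low-mono : ∀ {x y} → lookup σ x <ᶠ lookup σ y →
                    lookup (mirror σ) (low x) <ᶠ lookup (mirror σ) (low y)
  mirror-low-mono {x} {y} lt =
    subst₂ _<ᶠ_ (sym (mirror-low x)) (sym (mirror-low y)) (low-mono lt)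

  mirror-low-mono⁻ : ∀ {x y} → lookup (mirror σ) (low x) <ᶠ lookup (mirror σ) (low y) →
                     lookup σ x <ᶠ lookup σ y
  mirror-low-mono⁻ {x} {y} lt = low-mono⁻ (subst₂ _<ᶠ_ (mirror-low x) (mirror-low y) lt)

  mirror-IsPermutation : IsPermutation σ → IsPermutation (mirror σ)
  mirror-IsPermutation (inj , surj) =
    (λ {p} {q} → injective p q (block p) (block q)) , surjective
    where
    ≡⇒≮ : ∀ {p q : Fin (h + suc h)} → p ≡ q → ¬ (p <ᶠ q)
    ≡⇒≮ refl = <-irrefl refl
    injective : ∀ p q → Block p → Block q → lookup (mirror σ) p ≡ lookup (mirror σ) q → p ≡ q
    injective _ _ (left x)  (left y)  eq =
      cong low (inj (low-injective (trans (sym (mirror-low x)) (trans eq (mirror-low y)))))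
    injective _ _ (left x)  middle    eq =
      contradiction (low<mid _) (≡⇒≮ (trans (sym (mirror-low x)) (trans eq mirror-mid)))
    injective _ _ (left x)  (right y) eq =
      contradiction (low<opposite-low _ _)
        (≡⇒≮ (trans (sym (mirror-low x)) (trans eq (mirror-right y))))
    injective _ _ middle    (left y)  eq =
      contradiction (low<mid _) (≡⇒≮ (trans (sym (mirror-low y)) (trans (sym eq) mirror-mid)))
    injective _ _ middle    middle    eq = refl
    injective _ _ middle    (right y) eq =
      contradiction (mid<opposite-low _)
        (≡⇒≮ (trans (sym mirror-mid) (trans eq (mirror-right y))))
    injective _ _ (right x) (left y)  eq =
      contradiction (low<opposite-low _ _)
        (≡⇒≮ (trans (sym (mirror-low y)) (trans (sym eq) (mirror-right x))))
    injective _ _ (right x) middle    eq =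
      contradiction (mid<opposite-low _)
        (≡⇒≮ (trans (sym mirror-mid) (trans (sym eq) (mirror-right x))))
    injective _ _ (right x) (right y) eq =
      cong (opposite ∘ low) (inj (low-injective (opposite-injective
        (trans (sym (mirror-right x)) (trans eq (mirror-right y))))))
    surjective : Surjective _≡_ _≡_ (lookup (mirror σ))
    surjective q with block q
    ... | left y  = let x , eq = surj y in
      low x , λ { refl → trans (mirror-low x) (cong low (eq refl)) }
    ... | middle  = mid h , λ { refl → mirror-mid }
    ... | right y = let x , eq = surj y in
      opposite (low x) , λ { refl → trans (mirror-right x) (cong (opposite ∘ low) (eq refl)) }

  mirror-IsPermutation⁻ : IsPermutation (mirror σ) → IsPermutation σ
  mirror-IsPermutation⁻ (inj , surj) =
    (λ {x} {y} eq → low-injective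
      (inj (trans (mirror-low x) (trans (cong low eq) (sym (mirror-low y)))))) , surjective
    where
    surjective : Surjective _≡_ _≡_ (lookup σ)
    surjective y with surj (low y)
    ... | p , eq with block p
    ... | left x  = x , λ { refl → low-injective (trans (sym (mirror-low x)) (eq refl)) }
    ... | middle  = ⊥-elim (<-irrefl (cong toℕ (trans (sym (eq refl)) mirror-mid)) (low<mid y))
    ... | right x = ⊥-elim (<-irrefl (cong toℕ (trans (sym (eq refl)) (mirror-right x)))
                                     (low<opposite-low y _))

  mirror-Avoids321⁻ : Avoids321 (mirror σ) → Avoids321 σ
  mirror-Avoids321⁻ av (i , j , l , i<j , j<l , ij , jl) =
    av (low i , low j , low l , low-mono i<j , low-mono j<l ,
        mirror-low-mono ij , mirror-low-mono jl)

  -- If the middle entry of a 321 lies in the left half, the first does by position, and the last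
  -- does because no inversion leaves the half. The pattern then occurs in `σ`.
  mirror-left-pattern : Avoids321 σ → ∀ {i l} y →
    i <ᶠ low y → low y <ᶠ l → lookup (mirror σ) (low y) <ᶠ lookup (mirror σ) i →
    lookup (mirror σ) l <ᶠ lookup (mirror σ) (low y) → ⊥
  mirror-left-pattern av {i} {l} y i<y y<l iy yl with below-low i<y
  ... | x , refl with block l
  ... | left z  = av (x , y , z , low-mono⁻ i<y , low-mono⁻ y<l ,
                      mirror-low-mono⁻ iy , mirror-low-mono⁻ yl)
  ... | middle  = mirror-mid≮low yl
  ... | right z = mirror-right≮low yl

  -- The cases follow the block of the pattern's middle entry. Left is `mirror-left-pattern`; the
  -- middle place is impossible, since all letters before it are smaller than its own.
  mirror-Avoids321 : Avoids321 σ → Avoids321 (mirror σ)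
  mirror-Avoids321 av (i , j , l , i<j , j<l , ij , jl) with block j
  ... | left y  = mirror-left-pattern av y i<j j<l ij jl
  -- By `rc-mirror` the reflected triple is again a 321, now with its middle entry in the left half.
  ... | right y = mirror-left-pattern av y
        (subst (opposite l <ᶠ_) (opposite-involutive _) (opposite-anti j<l))
        (subst (_<ᶠ opposite i) (opposite-involutive _) (opposite-anti i<j))
        (subst (λ p → lookup (mirror σ) p <ᶠ lookup (mirror σ) (opposite l))
          (opposite-involutive _) (flip jl))
        (subst (λ p → lookup (mirror σ) (opposite i) <ᶠ lookup (mirror σ) p)
          (opposite-involutive _) (flip ij))
    where
    flip : ∀ {p q} → lookup (mirror σ) p <ᶠ lookup (mirror σ) q →
           lookup (mirror σ) (opposite q) <ᶠ lookup (mirror σ) (opposite p)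
    flip {p} {q} lt = rc-<⁻ (mirror σ)
      (subst (λ τ → lookup τ p <ᶠ lookup τ q) (sym rc-mirror) lt)
  ... | middle with block i
  ... | left x  = <-asym (subst₂ _<ᶠ_ mirror-mid (mirror-low x) ij) (low<mid _)
  ... | middle  = <-irrefl refl i<j
  ... | right x = <-asym i<j (mid<opposite-low x)

  -- No descent crosses a block boundary. The left half shows the descents of `σ` by their tops;
  -- reflection turns tops in the right half into bottoms of `σ`, which are equally many.
  des-mirror : des (mirror σ) ≡ des σ + des σ
  des-mirror = begin
    des (mirror σ)                       ≡⟨ des-tops (mirror σ) ⟩
    sum top                              ≡⟨ sum-↑ h top ⟩
    sum (top ∘ low) + (top (mid h) + sum (λ y → top (h ↑ʳ suc y)))
      ≡⟨ cong₂ _+_ leftDescents (cong₂ _+_ (indicator-no (isDescent? (mirror σ) (mid h)) midNot) rightDescents) ⟩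
    des σ + des σ                        ∎
    where
    open ≡-Reasoning
    top = indicator ∘ isDescent? (mirror σ)

    leftDescents : sum (top ∘ low) ≡ des σ
    leftDescents = trans (sum-cong-≗ λ x →
      indicator-cong (isDescent? (mirror σ) (low x)) (isDescent? σ x) (to x)
        (λ { (y , eq , gt) → low y ,
               trans (toℕ-low y) (trans eq (cong suc (sym (toℕ-low x)))) ,
               mirror-low-mono gt }))
      (sym (des-tops σ))
      where
      to : ∀ x → IsDescent (mirror σ) (low x) → IsDescent σ x
      to x (p , eq , gt) with block p
      ... | left y  = y , trans (sym (toℕ-low y)) (trans eq (cong suc (toℕ-low x))) ,
                      mirror-low-mono⁻ gt
      ... | middle  = ⊥-elim (mirror-mid≮low gt)
      ... | right y = ⊥-elim (mirror-right≮low gt)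

    midNot : ¬ IsDescent (mirror σ) (mid h)
    midNot (p , eq , gt) with block p
    ... | left y  = <-asym (subst (toℕ (mid h) <_) (sym eq) (n<1+n _)) (low<mid y)
    ... | middle  = <-irrefl refl gt
    ... | right y = mirror-right≮mid gt

    leftBottom : ∀ x → top (h ↑ʳ suc (opposite x)) ≡ indicator (isBottom? σ x)
    leftBottom x = begin
      top (h ↑ʳ suc (opposite x))                                  ≡⟨ cong top (opposite-low x) ⟨
      -- Invariance under `rc` supplies the form to which `rc-top` applies.
      top (opposite (low x))                                       ≡⟨ cong (λ τ → indicator (isDescent? τ (opposite (low x)))) rc-mirror ⟨
      indicator (isDescent? (rc (mirror σ)) (opposite (low x)))    ≡⟨ rc-top (mirror σ) (low x) ⟩
      indicator (isBottom? (mirror σ) (low x))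
        ≡⟨ indicator-cong (isBottom? (mirror σ) (low x)) (isBottom? σ x) to
             (λ { (y , eq , lt) → low y ,
                    trans (toℕ-low x) (trans eq (cong suc (sym (toℕ-low y)))) ,
                    mirror-low-mono lt }) ⟩
      indicator (isBottom? σ x)                                    ∎
      where
      to : IsBottom (mirror σ) (low x) → IsBottom σ x
      -- The top directly precedes the bottom `low x`, so it lies in the left half as well.
      to (p , eq , lt) with below-low {p = p} (subst (toℕ p <_) (sym eq) (n<1+n _))
      ... | y , refl = y , trans (sym (toℕ-low x)) (trans eq (cong suc (toℕ-low y))) ,
                       mirror-low-mono⁻ lt

    rightDescents : sum (λ y → top (h ↑ʳ suc y)) ≡ des σ
    rightDescents = trans (sum-opposite (λ y → top (h ↑ʳ suc y)))
      (trans (sum-cong-≗ leftBottom) (sym (des-bottoms σ)))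

-- Fixed points of `rc` are mirrors.

mirror-injective : {σ τ : Word h h} → mirror σ ≡ mirror τ → σ ≡ τ
mirror-injective {σ = σ} {τ} eq = Vec-ext λ x → low-injective
  (trans (sym (mirror-low σ x)) (trans (cong (λ w → lookup w (low x)) eq) (mirror-low τ x)))

-- Invariance makes the middle letter its own complement and lets the left half determine the right
-- half. It remains to see that the left half carries only low letters, which form `σ`.
rc-fixed⇒mirror : {τ : Word (h + suc h) (h + suc h)} → IsPermutation τ → Avoids321 τ →
                  rc τ ≡ τ → ∃[ σ ] τ ≡ mirror σ
rc-fixed⇒mirror {h} {τ} (inj , _) av fix = σ , Vec-ext λ p → go p (block p)
  where
  sym-τ : ∀ p → lookup τ (opposite p) ≡ opposite (lookup τ p)
  sym-τ p = trans (cong (λ w → lookup w (opposite p)) (sym fix)) (lookup-rc-opposite τ p)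

  τ-mid : lookup τ (mid h) ≡ mid h
  τ-mid = self-opposite⇒mid
    (trans (sym (sym-τ (mid h))) (cong (lookup τ) (opposite-mid h)))

  τ-low : ∀ x → ∃[ y ] lookup τ (low x) ≡ low y
  τ-low x with lookup τ (low x) in eq
  ... | q with block q
  ... | left y  = y , refl
  -- The middle letter is already taken by the middle position.
  ... | middle  = ⊥-elim (<-irrefl (cong toℕ (inj (trans eq (sym τ-mid)))) (low<mid x))
  -- The letters at low x, mid h and opposite (low x) would form the pattern 321.
  ... | right y = ⊥-elim (av (low x , mid h , opposite (low x) ,
        low<mid x , mid<opposite-low x ,
        subst₂ _<ᶠ_ (sym τ-mid) (sym eq) (mid<opposite-low y) ,
        subst₂ _<ᶠ_ (sym (trans (sym-τ (low x)) (trans (cong opposite eq) (opposite-involutive _))))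
          (sym τ-mid) (low<mid y)))

  σ : Word h h
  σ = Vec.tabulate (proj₁ ∘ τ-low)

  low-σ : ∀ x → lookup τ (low x) ≡ low (lookup σ x)
  low-σ x = trans (proj₂ (τ-low x)) (cong low (sym (lookup∘tabulate (proj₁ ∘ τ-low) x)))

  go : ∀ p → Block p → lookup τ p ≡ lookup (mirror σ) p
  go _ (left x)  = trans (low-σ x) (sym (mirror-low σ x))
  go _ middle    = trans τ-mid (sym (mirror-mid σ))
  go _ (right x) = trans (sym-τ (low x)) (trans (cong opposite (low-σ x)) (sym (mirror-right σ x)))

-- The lists of 321-avoiding permutations by descent number.

allWords-complete : (σ : Word a n) → σ ∈ allWords a n
allWords-complete []ᵛ      = here refl
allWords-complete (x ∷ᵛ σ) = ∈-cartesianProductWith⁺ _∷ᵛ_ (∈-allFin x) (allWords-complete σ)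

allWords-unique : ∀ a n → Unique (allWords a n)
allWords-unique a zero    = [] ∷ []
allWords-unique a (suc n) =
  Unique.cartesianProductWith⁺ _∷ᵛ_ ∷-injective (Unique.allFin⁺ a) (allWords-unique a n)

Av321-des : ∀ n → ℕ → List (Word n n)
Av321-des n k = filter (λ σ → des σ ≟ k) (Av321 n)

Av321-des-unique : ∀ n k → Unique (Av321-des n k)
Av321-des-unique n k =
  Unique.filter⁺ (λ σ → des σ ≟ k)
    (Unique.filter⁺ avoids321? (Unique.filter⁺ isPermutation? (allWords-unique n n)))

∈-Av321-des⁺ : {σ : Word n n} → IsPermutation σ → Avoids321 σ → des σ ≡ k → σ ∈ Av321-des n k
∈-Av321-des⁺ {k = k} {σ} perm av d =
  ∈-filter⁺ (λ σ → des σ ≟ k)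
    (∈-filter⁺ avoids321? (∈-filter⁺ isPermutation? (allWords-complete σ) perm) av) d

∈-Av321-des⁻ : {σ : Word n n} → σ ∈ Av321-des n k → IsPermutation σ × Avoids321 σ × des σ ≡ k
∈-Av321-des⁻ {n} {k} σ∈ =
  let σ∈Av , d = ∈-filter⁻ (λ σ → des σ ≟ k) {xs = Av321 n} σ∈
      σ∈𝔖 , av = ∈-filter⁻ avoids321? {xs = 𝔖 n} σ∈Av
      _ , perm = ∈-filter⁻ isPermutation? {xs = allWords n n} σ∈𝔖
  in perm , av , d

-- Counting fixed points and the induction on m.

rcFixed? : (σ : Word n n) → Dec (rc σ ≡ σ)
rcFixed? σ = ≡-dec _≟ᶠ_ (rc σ) σ

fixedPoints : ∀ h → ℕ → List (Word (h + suc h) (h + suc h))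
fixedPoints h k = filter rcFixed? (Av321-des (h + suc h) k)

-- Here `k` is arbitrary and its half appears as `des σ`, so an odd `k` needs no separate treatment:
-- no such `σ` exists then.
∈-fixedPoints⁻ : {τ : Word (h + suc h) (h + suc h)} → τ ∈ fixedPoints h k →
                 ∃[ σ ] (τ ≡ mirror σ × σ ∈ Av321-des h (des σ) × des σ + des σ ≡ k)
∈-fixedPoints⁻ {h} {k} τ∈ with ∈-filter⁻ rcFixed? {xs = Av321-des (h + suc h) k} τ∈
... | τ∈Av , fix with ∈-Av321-des⁻ τ∈Av
... | perm , av , d with rc-fixed⇒mirror perm av fix
... | σ , refl =
  σ , refl , ∈-Av321-des⁺ (mirror-IsPermutation⁻ σ perm) (mirror-Avoids321⁻ σ av) refl ,
  trans (sym (des-mirror σ)) d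

∈-fixedPoints⁺ : {σ : Word h h} → σ ∈ Av321-des h k → mirror σ ∈ fixedPoints h (k + k)
∈-fixedPoints⁺ {σ = σ} σ∈ with ∈-Av321-des⁻ σ∈
... | perm , av , refl =
  ∈-filter⁺ rcFixed?
    (∈-Av321-des⁺ (mirror-IsPermutation σ perm) (mirror-Avoids321 σ av) (des-mirror σ))
    (rc-mirror σ)

double-injective : ∀ {m n} → m + m ≡ n + n → m ≡ n
double-injective eq = ≤-antisym
  (≮⇒≥ λ lt → <-irrefl (sym eq) (+-mono-< lt lt))
  (≮⇒≥ λ lt → <-irrefl eq (+-mono-< lt lt))

-- `mirror` is injective and doubles descents, so both repetition-free lists have the same members
-- once `mirror` is applied to the second.
length-fixedPoints : ∀ h k → length (fixedPoints h (k + k)) ≡ length (Av321-des h k)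
length-fixedPoints h k = trans (↭-length fixed↭mirrors) (length-map mirror (Av321-des h k))
  where
  fixed↭mirrors : fixedPoints h (k + k) ↭ map mirror (Av321-des h k)
  fixed↭mirrors = Unique⇒↭
    (Unique.filter⁺ rcFixed? (Av321-des-unique (h + suc h) (k + k)))
    (Unique.map⁺ mirror-injective (Av321-des-unique h k))
    (λ τ∈ → let σ , eq , σ∈ , d = ∈-fixedPoints⁻ {h} {k + k} τ∈ in
      subst (_∈ map mirror (Av321-des h k)) (sym eq)
        (∈-map⁺ mirror (subst (λ d → σ ∈ Av321-des h d) (double-injective d) σ∈)))
    (λ τ∈ → let σ , σ∈ , eq = ∈-map⁻ mirror {xs = Av321-des h k} τ∈ in
      subst (_∈ fixedPoints h (k + k)) (sym eq) (∈-fixedPoints⁺ {h} {k} σ∈))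

EvenCounts : ℕ → Set
EvenCounts n = ∀ k → k ≥ 1 → 2 ∣ length (Av321-des n k)

-- An empty list has even length. Otherwise its first member reveals `k` as twice some `des σ`,
-- which is positive since `k` is, and the hypothesis for `h` applies there.
fixedPoints-even : EvenCounts h → ∀ k → k ≥ 1 → 2 ∣ length (fixedPoints h k)
fixedPoints-even {h} even k k≥1 with fixedPoints h k in eq
... | []     = 2 ∣0
... | τ ∷ τs with ∈-fixedPoints⁻ {h} {k} (subst (τ ∈_) (sym eq) (here refl))
... | σ , _ , _ , refl =
  subst (2 ∣_) (trans (sym (length-fixedPoints h (des σ))) (cong length eq))
    (even (des σ) (halfPositive (des σ) k≥1))
  where
  halfPositive : ∀ d → d + d ≥ 1 → d ≥ 1
  halfPositive (suc d) _ = s≤s z≤n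

evenCounts-step : EvenCounts h → EvenCounts (h + suc h)
evenCounts-step {h} even k k≥1 =
  involution-even rc rc-involutive rcFixed? (Av321-des (h + suc h) k)
    (Av321-des-unique (h + suc h) k)
    (λ {σ} σ∈ → let perm , av , d = ∈-Av321-des⁻ σ∈ in
      ∈-Av321-des⁺ (rc-IsPermutation σ perm) (rc-Avoids321 σ av) (trans (des-rc σ) d))
    (fixedPoints-even {h} even k k≥1)

-- The empty word has no descents, so for positive `k` the list computes to `[]`.
evenCounts-0 : EvenCounts 0
evenCounts-0 (suc k) _ = 2 ∣0

-- Gives the exponent step the shape of `evenCounts-step`. Positivity of `2 ^ m` rules out the case
-- in which the subtraction would truncate.
2^1+m∸1 : ∀ m → 2 ^ suc m ∸ 1 ≡ (2 ^ m ∸ 1) + suc (2 ^ m ∸ 1)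
2^1+m∸1 m with 2 ^ m | m^n>0 2 m
... | suc p | _ = cong (p +_) (cong suc (+-identityʳ p))

evenCounts : ∀ m → EvenCounts (2 ^ m ∸ 1)
evenCounts zero    = evenCounts-0
evenCounts (suc m) = subst EvenCounts (sym (2^1+m∸1 m)) (evenCounts-step {2 ^ m ∸ 1} (evenCounts m))

-- The only permutation without descents.

noDescents⇒increasing : (σ : Word n n) → IsPermutation σ → des σ ≡ 0 →
  ∀ {i j} → toℕ j ≡ suc (toℕ i) → lookup σ i <ᶠ lookup σ j
noDescents⇒increasing σ (inj , _) d {i} {j} eq = ≤∧≢⇒<
  (≮⇒≥ λ gt → <-irrefl (sym d) (filter-some (isDescent? σ) (lose (∈-allFin i) (j , eq , gt))))
  (λ same → <-irrefl (cong toℕ (inj (toℕ-injective same))) (subst (toℕ i <_) (sym eq) (n<1+n _)))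

-- Letters rise by at least one at each step, starting from at least 0. The extra `m` makes the
-- recursion structural, as `inject₁ i` is not a subterm of `suc i`.
noDescents⇒≥ : (σ : Word n n) → IsPermutation σ → des σ ≡ 0 →
               ∀ m (i : Fin n) → toℕ i ≡ m → m ≤ toℕ (lookup σ i)
noDescents⇒≥ σ perm d zero    i       eq = z≤n
noDescents⇒≥ σ perm d (suc m) (suc i) eq = ≤-trans
  (s≤s (noDescents⇒≥ σ perm d m (inject₁ i) (trans (toℕ-inject₁ i) (suc-injective eq))))
  (noDescents⇒increasing σ perm d (cong suc (sym (toℕ-inject₁ i))))

identity : ∀ n → Word n n
identity n = Vec.tabulate id

lookup-identity : (i : Fin n) → lookup (identity n) i ≡ i
lookup-identity = lookup∘tabulate id

-- σ lies above the identity, and so does rc σ; together they bound σ on both sides.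
noDescents⇒identity : {σ : Word n n} → IsPermutation σ → des σ ≡ 0 → σ ≡ identity n
noDescents⇒identity {σ = σ} perm d = Vec-ext λ i →
  trans (toℕ-injective (≤-antisym (above i) (noDescents⇒≥ σ perm d _ i refl)))
    (sym (lookup-identity i))
  where
  above : ∀ i → toℕ (lookup σ i) ≤ toℕ i
  above i = ≮⇒≥ λ lt → <⇒≱ (opposite-anti lt)
    (subst (λ q → toℕ (opposite i) ≤ toℕ q) (lookup-rc-opposite σ i)
      (noDescents⇒≥ (rc σ) (rc-IsPermutation σ perm) (trans (des-rc σ) d) _ (opposite i) refl))

identity-< : {i j : Fin n} → lookup (identity n) i <ᶠ lookup (identity n) j → i <ᶠ j
identity-< {i = i} {j} = subst₂ _<ᶠ_ (lookup-identity i) (lookup-identity j)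

identity∈Av321-des : ∀ n → identity n ∈ Av321-des n 0
identity∈Av321-des n = ∈-Av321-des⁺
  ((λ {i} {j} eq → trans (sym (lookup-identity i)) (trans eq (lookup-identity j))) ,
   λ y → y , λ { refl → lookup-identity y })
  (λ { (_ , _ , _ , i<j , _ , ij , _) → <-asym i<j (identity-< ij) })
  (cong length (filter-none (isDescent? (identity n)) {xs = allFin n}
    (All.universal (λ { i (j , eq , gt) →
      <-asym (identity-< gt) (subst (toℕ i <_) (sym eq) (n<1+n _)) }) (allFin n))))

length-Av321-des-0 : ∀ n → length (Av321-des n 0) ≡ 1
length-Av321-des-0 n = ↭-length (Unique⇒↭ (Av321-des-unique n 0) ([] ∷ [])
  (λ σ∈ → let perm , _ , d = ∈-Av321-des⁻ σ∈ in here (noDescents⇒identity perm d))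
  (λ { (here refl) → identity∈Av321-des n }))

theorem2p5 : ∀ (m n : ℕ) → n ≡ 2 ^ m ∸ 1 →
    A n 0 1 ≡ 1 × (∀ (k : ℕ) → k ≥ 1 → 2 ∣ A n k 1)
theorem2p5 m n refl =
  trans (A-count n 0) (length-Av321-des-0 n) ,
  λ k k≥1 → subst (2 ∣_) (sym (A-count n k)) (evenCounts m k k≥1)
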